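{- In base $3$, there is a unique infinite path in the child graph $G_c$ that starts at $1$; that is, there is exactly one infinite sequence of positive integers $a(1), a(2), a(3), \ldots$ with $a(1) = 1$ such that $a(n+1)$ is a comma-child of $a(n)$ in base $3$ for every $n \ge 1$. Moreover, this path is constructed by the following rule: starting from $1$, at a node with exactly one comma-child the path moves to that child, and at the successive branch-points reached along the path (the first of which is the node $1$ itself) the path alternately chooses the lower and the higher of the two comma-children (lower at the first branch-point, higher at the second, lower at the third, and so on).
   Context: Work in base $b = 3$. For a positive integer $n$, let $\delta(n)$ denote its leading (most significant, nonzero) base-$b$ digit. For positive integers $k, k'$, we say that $k'$ is a comma-child of $k$ (in base $b$) if $k' - k = d\cdot b + \delta(k')$, where $d = k \bmod b$ is the last base-$b$ digit of $k$. (A positive integer has at most two comma-children.) The child graph $G_c$ (in base $b$) is the directed graph whose nodes are the positive integers, with an edge from $i$ to $j$ exactly when $j$ is a comma-child of $i$. Paths are directed paths. A branch-point is a node with exactly two comma-children. -}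

module Defs where

open import Data.Digit using (Digit; Expansion; fromDigits)
open import Data.Fin.Base using (toℕ)
open import Data.List.Base using (_∷ʳ_)
open import Data.Nat.Base using (ℕ; suc; _+_; _*_; _%_; _<_; NonZero)
open import Data.Product.Base using (_×_; ∃-syntax; ∃₂; Σ-syntax)
open import Data.Sum.Base using (_⊎_)
open import Relation.Binary.PropositionalEquality using (_≡_)

-- Expansions list the least significant digit first, so δ, the last entry,
-- is the most significant digit.
LeadingDigit : (b n : ℕ) → Digit b → Set
LeadingDigit b n δ =
  0 < toℕ δ × ∃[ ds ] fromDigits {b} (ds ∷ʳ δ) ≡ n

data Choice : Set where
  lower higher : Choice

module _ (b : ℕ) .{{_ : NonZero b}} where

  -- CommaChild k k′ says that k′ is a comma-child of k.  The equation
  -- k′ - k = d * b + δ(k′) is written additively, with d = k % b.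
  -- Nodes of the child graph are positive, hence the first two fields.
  record CommaChild (k k′ : ℕ) : Set where
    field
      k-positive   : 0 < k
      k′-positive  : 0 < k′
      δ            : Digit b
      δ-leading    : LeadingDigit b k′ δ
      k′≡k+[d*b+δ] : k′ ≡ k + (k % b * b + toℕ δ)

  OnlyChild : (k j : ℕ) → Set
  OnlyChild k j = CommaChild k j × (∀ i → CommaChild k i → i ≡ j)

  -- The comma-children of k are exactly l and h, with l the lower one.
  TwoChildren : (k l h : ℕ) → Set
  TwoChildren k l h =
    l < h × CommaChild k l × CommaChild k h ×
    (∀ i → CommaChild k i → i ≡ l ⊎ i ≡ h)

  BranchPoint : ℕ → Set
  BranchPoint k = ∃₂ (TwoChildren k)

  -- Sequences are indexed from 0: the term a(n + 1) of the usual numbering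
  -- from 1 is a n here.
  InfinitePathFrom : ℕ → (ℕ → ℕ) → Set
  InfinitePathFrom s a = a 0 ≡ s × (∀ n → CommaChild (a n) (a (suc n)))

  -- Move c k c′ k′ : with c the choice to be made at the next branch-point
  -- (possibly k itself), the alternating rule moves from k to k′, after which
  -- c′ is the choice to be made at the next branch-point.
  data Move : Choice → ℕ → Choice → ℕ → Set where
    only      : ∀ {c k j} → OnlyChild k j     → Move c k c j
    go-lower  : ∀ {k l h} → TwoChildren k l h → Move lower k higher l
    go-higher : ∀ {k l h} → TwoChildren k l h → Move higher k lower h

  FollowsAlternatingRule : (ℕ → ℕ) → Set
  FollowsAlternatingRule a =
    Σ[ c ∈ (ℕ → Choice) ] c 0 ≡ lower × (∀ n → Move (c n) (a n) (c (suc n)) (a (suc n)))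

{-# OPTIONS --safe #-}
module Submission where

-- Between consecutive numbers of the forms 3^m and 2·3^m the leading digit is
-- constant, every node not near the end has one child, and the last digit
-- returns after three steps, which advance by 12 or by 15.  So the offset at which a path enters such
-- a block, together with 3^m modulo 12 or 15, determines the offset at which it
-- enters the next one.  Paths branch only at nodes 2·3^m - 5 and stop
-- only at nodes 3^m - 5.  As 3^m modulo 60 depends only on m mod 4 for m ≥ 1, a
-- finite computation of offsets decides which child at a branch-point leads to
-- an infinite path: with Q = 9·81^j, the path takes the higher child at 2Q - 5,
-- next reaches the branch-point 54Q - 5, takes the lower child there, and comes
-- to 162Q - 5, which is 2Q - 5 with j increased by one.  The children not taken
-- only lead to dead ends.

open import Data.Digit using (Digit; fromDigits)
open import Data.Empty using (⊥; ⊥-elim)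
open import Data.Fin.Base using (toℕ)
open import Data.Fin.Patterns using (0F; 1F; 2F)
open import Data.Fin.Properties using (toℕ<n; toℕ-injective)
open import Data.List.Base using ([]; _∷_; _∷ʳ_)
open import Data.Nat.Base
open import Data.Nat.DivMod
open import Data.Nat.Properties
open import Data.Nat.Tactic.RingSolver using (solve-∀)
open import Data.Product using (_×_; _,_; proj₁; proj₂; ∃-syntax; ∃!)
open import Data.Sum.Base as Sum using (_⊎_; inj₁; inj₂; [_,_]′)
open import Function.Base using (case_of_)
open import Relation.Binary.Construct.Closure.ReflexiveTransitive using (Star; ε; _◅_; _◅◅_; gmap)
open import Relation.Binary.PropositionalEquality
open import Relation.Nullary.Decidable using (yes; no; True; toWitness)
open import Relation.Nullary.Negation using (contradiction)

open import Defs

-- Leading digits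

module _ {b : ℕ} .{{_ : NonZero b}} where

  digit-injective : ∀ (d e : Digit b) x y → toℕ d + x * b ≡ toℕ e + y * b → d ≡ e × x ≡ y
  digit-injective d e x y eq = toℕ-injective d≡e ,
    *-cancelʳ-≡ x y b (+-cancelˡ-≡ (toℕ e) _ _ (trans (cong (_+ x * b) (sym d≡e)) eq))
    where
    last-digit : ∀ (c : Digit b) z → (toℕ c + z * b) % b ≡ toℕ c
    last-digit c z = trans ([m+kn]%n≡m%n (toℕ c) z b) (m<n⇒m%n≡m (toℕ<n c))

    d≡e : toℕ d ≡ toℕ e
    d≡e = trans (sym (last-digit d x)) (trans (cong (_% b) eq) (last-digit e y))

  fromDigits-positive : ∀ ds {δ : Digit b} → 0 < toℕ δ → 0 < fromDigits (ds ∷ʳ δ)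
  fromDigits-positive []       0<δ = ≤-trans 0<δ (m≤m+n _ _)
  fromDigits-positive (d ∷ ds) 0<δ =
    ≤-trans (*-mono-≤ (fromDigits-positive ds 0<δ) (>-nonZero⁻¹ b)) (m≤n+m _ (toℕ d))

  -- Equal last digits are stripped from both expansions in step. If one list ended first, its
  -- quotient 0 would equal the other's, which is positive.
  LeadingDigit-unique : ∀ {n δ η} → LeadingDigit b n δ → LeadingDigit b n η → δ ≡ η
  LeadingDigit-unique {n} {δ} {η} (0<δ , ds , p) (0<η , es , q) = go ds es (trans p (sym q))
    where
    go : ∀ ds es → fromDigits (ds ∷ʳ δ) ≡ fromDigits (es ∷ʳ η) → δ ≡ η
    go []       []       eq = proj₁ (digit-injective δ η 0 0 eq)
    go []       (e ∷ es) eq = contradiction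
      (proj₂ (digit-injective δ e 0 _ eq)) (<⇒≢ (fromDigits-positive es 0<η))
    go (d ∷ ds) []       eq = contradiction
      (sym (proj₂ (digit-injective d η _ 0 eq))) (<⇒≢ (fromDigits-positive ds 0<δ))
    go (d ∷ ds) (e ∷ es) eq = go ds es (proj₂ (digit-injective d e _ _ eq))

  LeadingDigit-intro : ∀ m {δ : Digit b} {n} → 0 < toℕ δ →
    toℕ δ * b ^ m ≤ n → n < suc (toℕ δ) * b ^ m → LeadingDigit b n δ
  LeadingDigit-intro zero {δ} {n} 0<δ lo hi = 0<δ , [] , trans (+-identityʳ _)
    (≤-antisym (subst (_≤ n) (*-identityʳ (toℕ δ)) lo)
               (s≤s⁻¹ (subst (n <_) (*-identityʳ (suc (toℕ δ))) hi)))
  LeadingDigit-intro (suc m) {δ} {n} 0<δ lo hi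
    with LeadingDigit-intro m {δ} {n / b} 0<δ lo′ hi′
    where
    shift : ∀ x → x * b ^ suc m ≡ x * b ^ m * b
    shift x = trans (cong (x *_) (*-comm b (b ^ m))) (sym (*-assoc x (b ^ m) b))

    lo′ : toℕ δ * b ^ m ≤ n / b
    lo′ = subst (_≤ n / b) (m*n/n≡m (toℕ δ * b ^ m) b)
      (/-monoˡ-≤ b (subst (_≤ n) (shift (toℕ δ)) lo))

    hi′ : n / b < suc (toℕ δ) * b ^ m
    hi′ = m<n*o⇒m/o<n (subst (n <_) (shift (suc (toℕ δ))) hi)
  ... | _ , ds , eq = 0<δ , n mod b ∷ ds ,
    trans (cong (λ q → toℕ (n mod b) + q * b) eq) (sym (DivMod.property (n divMod b)))

-- Comma-children in base 3

-- The leading digit, 1 or 2, fixes a child, so there are two candidates. If both of them lead with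
-- `δ`, only the candidate for `δ` is consistent.
isolate : ∀ {k d δ} → 0 < k → k % 3 ≡ d → 0 < toℕ δ →
  (∀ {n} → k + (d * 3 + 1) ≤ n → n ≤ k + (d * 3 + 2) → LeadingDigit 3 n δ) →
  OnlyChild 3 k (k + (d * 3 + toℕ δ))
isolate {k} {d} {δ} 0<k refl 0<δ leads = record
  { k-positive = 0<k
  ; k′-positive = ≤-trans 0<k (m≤m+n k _)
  ; δ = δ
  ; δ-leading = leads′ δ 0<δ
  ; k′≡k+[d*b+δ] = refl
  } , unique
  where
  leads′ : ∀ (x : Digit 3) → 0 < toℕ x → LeadingDigit 3 (k + (d * 3 + toℕ x)) δ
  leads′ x 0<x = leads (+-monoʳ-≤ k (+-monoʳ-≤ (d * 3) 0<x))
                       (+-monoʳ-≤ k (+-monoʳ-≤ (d * 3) (s≤s⁻¹ (toℕ<n x))))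

  unique : ∀ i → CommaChild 3 k i → i ≡ k + (d * 3 + toℕ δ)
  unique i c = trans (CommaChild.k′≡k+[d*b+δ] c) (cong (λ x → k + (d * 3 + toℕ x)) x≡δ)
    where
    x = CommaChild.δ c

    x≡δ : x ≡ δ
    x≡δ = LeadingDigit-unique (CommaChild.δ-leading c)
      (subst (λ n → LeadingDigit 3 n δ) (sym (CommaChild.k′≡k+[d*b+δ] c))
        (leads′ x (proj₁ (CommaChild.δ-leading c))))

-- Blocks

-- Opaque, so that comparing block boundaries never unfolds powers of 3.
opaque
  size : ℕ → ℕ
  size m = 3 ^ (2 + m)

  size-unfold : ∀ m → size m ≡ 3 ^ (2 + m)
  size-unfold m = refl

  size-suc : ∀ m → size (suc m) ≡ 3 * size m
  size-suc m = refl

-- The exponent is shifted by 2: low m stands for the numbers n with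
-- 3^(2+m) ≤ n < 2·3^(2+m), and high m for those with 2·3^(2+m) ≤ n < 3^(3+m).
-- Shorter blocks can be jumped over.
data Block : Set where
  low high : ℕ → Block

next : Block → Block
next (low m)  = high m
next (high m) = low (suc m)

lead : Block → Digit 3
lead (low _)  = 1F
lead (high _) = 2F

start : Block → ℕ
start (low m)  = size m
start (high m) = 2 * size m

end : Block → ℕ
end b = start (next b)

exponent : Block → ℕ
exponent (low m)  = m
exponent (high m) = m

9≤size : ∀ m → 9 ≤ size m
9≤size m = ≤-trans (*-monoʳ-≤ 9 (m^n>0 3 m))
  (≤-reflexive (trans (*-assoc 3 3 (3 ^ m)) (sym (size-unfold m))))

0<lead : ∀ b → 0 < toℕ (lead b)
0<lead (low _)  = s≤s z≤n
0<lead (high _) = s≤s z≤n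

start≡ : ∀ b → start b ≡ toℕ (lead b) * size (exponent b)
start≡ (low m)  = sym (+-identityʳ _)
start≡ (high m) = refl

end≡ : ∀ b → end b ≡ suc (toℕ (lead b)) * size (exponent b)
end≡ (low m)  = refl
end≡ (high m) = size-suc m

end≡start+size : ∀ b → end b ≡ start b + size (exponent b)
end≡start+size b = trans (end≡ b)
  (trans (+-comm (size (exponent b)) _) (cong (_+ size (exponent b)) (sym (start≡ b))))

start+9≤end : ∀ b → start b + 9 ≤ end b
start+9≤end b = ≤-trans (+-monoʳ-≤ (start b) (9≤size (exponent b)))
  (≤-reflexive (sym (end≡start+size b)))

0<start : ∀ b → 0 < start b
0<start b = subst (0 <_) (sym (start≡ b))
  (*-mono-≤ (0<lead b) (≤-trans (s≤s z≤n) (9≤size (exponent b))))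

end%3≡0 : ∀ b → end b % 3 ≡ 0
end%3≡0 b = trans (cong (_% 3) end≡q*3) (m*n%n≡0 q 3)
  where
  m = exponent b
  l = suc (toℕ (lead b))
  q = l * 3 ^ suc m

  end≡q*3 : end b ≡ q * 3
  end≡q*3 = trans (end≡ b) (trans (cong (l *_)
    (trans (size-unfold m) (*-comm 3 (3 ^ suc m)))) (sym (*-assoc l (3 ^ suc m) 3)))

LeadingDigit-block : ∀ b {n} → start b ≤ n → n < end b → LeadingDigit 3 n (lead b)
LeadingDigit-block b {n} lo hi = LeadingDigit-intro (2 + exponent b) (0<lead b)
  (subst (_≤ n) (trans (start≡ b) (cong (toℕ (lead b) *_) (size-unfold (exponent b)))) lo)
  (subst (n <_) (trans (end≡ b) (cong (suc (toℕ (lead b)) *_) (size-unfold (exponent b)))) hi)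

child-inside : ∀ b {k d} → start b ≤ k → k % 3 ≡ d → k + (d * 3 + 2) < end b →
  OnlyChild 3 k (k + (d * 3 + toℕ (lead b)))
child-inside b {k} lo k%3 hi = isolate (≤-trans (0<start b) lo) k%3 (0<lead b)
  λ lo′ hi′ → LeadingDigit-block b (≤-trans lo (≤-trans (m≤m+n k _) lo′)) (≤-<-trans hi′ hi)

-- Every block has length at least 9, so both candidates lie in the next block.
child-beyond : ∀ b {k d} → 0 < k → k % 3 ≡ d → end b ≤ k + (d * 3 + 1) →
  k + (d * 3 + 2) < end b + 9 → OnlyChild 3 k (k + (d * 3 + toℕ (lead (next b))))
child-beyond b {k} 0<k k%3 lo hi = isolate 0<k k%3 (0<lead (next b))
  λ lo′ hi′ → LeadingDigit-block (next b) (≤-trans lo lo′)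
    (<-≤-trans (≤-<-trans hi′ hi) (start+9≤end (next b)))

-- Runs of forced moves

Run : ℕ → ℕ → Set
Run = Star (OnlyChild 3)

stride : Block → ℕ → ℕ
stride b d = d * 3 + toℕ (lead b)

stride-bound : ∀ b d → d * 3 + 2 < stride b d + 2
stride-bound b d = subst (_< stride b d + 2) (+-comm 2 (d * 3))
  (subst (2 + d * 3 <_) (+-comm 2 (stride b d)) (+-monoʳ-< 2 (m<m+n (d * 3) (0<lead b))))

glide : ∀ b {k d} → start b ≤ k → k % 3 ≡ d → k + (stride b d + 2) ≤ end b →
  OnlyChild 3 k (k + stride b d)
glide b {k} {d} lo k%3 hi =
  child-inside b lo k%3 (<-≤-trans (+-monoʳ-< k (stride-bound b d)) hi)

-- A step inside a block adds the leading digit to the last digit modulo 3. Three steps thus meet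
-- each last digit once and advance by 3 * (0 + 1 + 2) plus three times the leading digit.
period : Block → ℕ
period (low _)  = 12
period (high _) = 15

-- The later last digits are expressed through `d`, so that `x + y + z` computes to the period once
-- `d` is a numeral.
glide³ : ∀ b {k d} → start b ≤ k → k % 3 ≡ d →
  let x = stride b d
      y = stride b ((d + x) % 3)
      z = stride b (((d + x) % 3 + y) % 3)
  in k + (x + y + z + 2) ≤ end b → Run k (k + (x + y + z))
glide³ b {k} {d} lo k%3 hi =
  glide b lo k%3 (≤-trans (+-monoʳ-≤ k (+-monoˡ-≤ 2 x≤)) hi) ◅
  subst (Run (k + x)) (trans (cong (_+ z) (+-assoc k x y)) (+-assoc k (x + y) z))
  ( glide b (≤-trans lo (m≤m+n k x)) k₁%3
      (≤-trans (≤-reflexive (+-assoc k x _))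
        (≤-trans (+-monoʳ-≤ k (≤-trans (≤-reflexive (sym (+-assoc x y 2))) (+-monoˡ-≤ 2 xy≤))) hi))
  ◅ glide b (≤-trans lo (≤-trans (m≤m+n k x) (m≤m+n (k + x) y))) k₂%3
      (≤-trans (≤-reflexive (lemma k x y z)) hi)
  ◅ ε )
  where
  x = stride b d
  d₁ = (d + x) % 3
  y = stride b d₁
  d₂ = (d₁ + y) % 3
  z = stride b d₂

  x≤ : x ≤ x + y + z
  x≤ = ≤-trans (m≤m+n x y) (m≤m+n (x + y) z)

  xy≤ : x + y ≤ x + y + z
  xy≤ = m≤m+n (x + y) z

  lemma : ∀ k x y z → k + x + y + (z + 2) ≡ k + (x + y + z + 2)
  lemma = solve-∀

  last-digit-+ : ∀ m c w → m % 3 ≡ c → (m + w) % 3 ≡ (c + w) % 3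
  last-digit-+ m c w refl = trans (%-distribˡ-+ m w 3) (trans
    (cong (λ v → (v + w % 3) % 3) (sym (m%n%n≡m%n m 3))) (sym (%-distribˡ-+ (m % 3) w 3)))

  k₁%3 : (k + x) % 3 ≡ d₁
  k₁%3 = last-digit-+ k d x k%3

  k₂%3 : (k + x + y) % 3 ≡ d₂
  k₂%3 = last-digit-+ (k + x) d₁ y k₁%3

glide-period : ∀ b {k} → start b ≤ k → k + (period b + 2) ≤ end b → Run k (k + period b)
glide-period b {k} lo hi with k % 3 in k%3 | m%n<n k 3
glide-period b@(low _)  lo hi | 0 | _ = glide³ b lo k%3 hi
glide-period b@(low _)  lo hi | 1 | _ = glide³ b lo k%3 hi
glide-period b@(low _)  lo hi | 2 | _ = glide³ b lo k%3 hi
glide-period b@(high _) lo hi | 0 | _ = glide³ b lo k%3 hi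
glide-period b@(high _) lo hi | 1 | _ = glide³ b lo k%3 hi
glide-period b@(high _) lo hi | 2 | _ = glide³ b lo k%3 hi
... | suc (suc (suc _)) | s≤s (s≤s (s≤s ()))

glide-periods : ∀ b t {k} → start b ≤ k → k + (t * period b + 2) ≤ end b →
  Run k (k + t * period b)
glide-periods b zero    {k} lo hi = subst (Run k) (sym (+-identityʳ k)) ε
glide-periods b (suc t) {k} lo hi =
  glide-period b lo (≤-trans (+-monoʳ-≤ k (+-monoˡ-≤ 2 (m≤m+n p (t * p)))) hi) ◅◅
  subst (Run (k + p)) (+-assoc k p (t * p))
    (glide-periods b t (≤-trans lo (m≤m+n k p)) (subst (_≤ end b) (lemma k p (t * p)) hi))
  where
  p = period b

  lemma : ∀ k p q → k + (p + q + 2) ≡ k + p + (q + 2)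
  lemma = solve-∀

-- Crossing a block by evaluation

data Outcome : Set where
  crosses halts : ℕ → Outcome

-- walk f b g follows the run from end b - g: crosses e means that it leaves b
-- for end b + e, halts h that it reaches end b - h.  f is fuel.
walk : ℕ → Block → ℕ → Outcome
walk zero    b g = halts g
walk (suc f) b g with g ≤? 2 * g % 3 * 3 + 1 | 2 * g % 3 * 3 + 2 <? g
... | yes _ | _     = crosses (stride (next b) (2 * g % 3) ∸ g)
... | no _  | yes _ = walk f b (g ∸ stride b (2 * g % 3))
... | no _  | no _  = halts g

place : Block → Outcome → ℕ
place b (crosses e) = end b + e
place b (halts h)   = end b ∸ h

-- Since 3 divides `end b`, `k` is congruent to -g, hence to 2g. The gap alone therefore determines
-- the last digit.
last-digit-gap : ∀ b k g → k + g ≡ end b → k % 3 ≡ 2 * g % 3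
last-digit-gap b k g eq = begin
  k % 3                          ≡⟨ [m+kn]%n≡m%n k g 3 ⟨
  (k + g * 3) % 3                ≡⟨ cong (_% 3) (lemma k g) ⟩
  (k + g + 2 * g) % 3            ≡⟨ cong (λ n → (n + 2 * g) % 3) eq ⟩
  (end b + 2 * g) % 3            ≡⟨ %-distribˡ-+ (end b) (2 * g) 3 ⟩
  (end b % 3 + 2 * g % 3) % 3    ≡⟨ cong (λ n → (n + 2 * g % 3) % 3) (end%3≡0 b) ⟩
  2 * g % 3 % 3                  ≡⟨ m%n%n≡m%n (2 * g) 3 ⟩
  2 * g % 3                      ∎
  where
  open ≡-Reasoning
  lemma : ∀ k g → k + g * 3 ≡ k + g + 2 * g
  lemma = solve-∀

walk-run : ∀ f b g {k} → start b ≤ k → k + g ≡ end b → Run k (place b (walk f b g))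
walk-run zero b g {k} lo eq = subst (Run k) (trans (sym (m+n∸n≡m k g)) (cong (_∸ g) eq)) ε
walk-run (suc f) b g {k} lo eq with g ≤? 2 * g % 3 * 3 + 1 | 2 * g % 3 * 3 + 2 <? g
-- Here the candidates straddle the boundary: g = 3d + 2 with d = 2g mod 3, which forces d = 1 and g
-- = 5.
... | no _ | no _ = walk-run zero b g lo eq
... | no _ | yes hi =
  child-inside b lo (last-digit-gap b k g eq)
    (<-≤-trans (+-monoʳ-< k hi) (≤-reflexive eq)) ◅
  walk-run f b (g ∸ x) (≤-trans lo (m≤m+n k x))
    (trans (+-assoc k x _) (trans (cong (k +_) (m+[n∸m]≡n x≤g)) eq))
  where
  x = stride b (2 * g % 3)

  x≤g : x ≤ g
  x≤g = ≤-trans (+-monoʳ-≤ (2 * g % 3 * 3) (s≤s⁻¹ (toℕ<n (lead b)))) (<⇒≤ hi)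
... | yes hi | _ = subst (OnlyChild 3 k) k+x≡
  (child-beyond b (≤-trans (0<start b) lo) (last-digit-gap b k g eq)
    (≤-trans (≤-reflexive (sym eq)) (+-monoʳ-≤ k hi)) k+9) ◅ ε
  where
  d = 2 * g % 3
  x = stride (next b) d

  k+9 : k + (d * 3 + 2) < end b + 9
  k+9 = ≤-<-trans (+-mono-≤ (m+n≤o⇒m≤o k (≤-reflexive eq))
      (+-monoˡ-≤ 2 (*-monoˡ-≤ 3 (s≤s⁻¹ (m%n<n (2 * g) 3)))))
    (+-monoʳ-< (end b) (n<1+n 8))

  k+x≡ : k + x ≡ end b + (x ∸ g)
  k+x≡ = trans (cong (k +_) (sym (m+[n∸m]≡n (≤-trans hi (+-monoʳ-≤ (d * 3) (0<lead (next b)))))))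
    (trans (sym (+-assoc k g _)) (cong (_+ (x ∸ g)) eq))

-- 80·3^n is divisible by 720 for n ≥ 2, and 720 is a multiple of both periods.
size-cyclic : ∀ r j → ∃[ s ] size (r + j * 4) ≡ 3 ^ (2 + r) + s * 720
size-cyclic r zero    = 0 , trans (cong size (+-identityʳ r))
  (trans (size-unfold r) (sym (+-identityʳ _)))
size-cyclic r (suc j) with size-cyclic r j
... | s , eq = s + 3 ^ (r + j * 4) , (begin
  size (r + suc j * 4)                             ≡⟨ cong size (shift r (j * 4)) ⟩
  size (4 + (r + j * 4))                           ≡⟨ size-unfold _ ⟩
  3 ^ (6 + (r + j * 4))                            ≡⟨ lemma (3 ^ (r + j * 4)) ⟩
  3 ^ (2 + (r + j * 4)) + 3 ^ (r + j * 4) * 720    ≡⟨ cong (_+ 3 ^ (r + j * 4) * 720) (trans (sym (size-unfold _)) eq) ⟩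
  3 ^ (2 + r) + s * 720 + 3 ^ (r + j * 4) * 720    ≡⟨ +-assoc (3 ^ (2 + r)) _ _ ⟩
  3 ^ (2 + r) + (s * 720 + 3 ^ (r + j * 4) * 720)  ≡⟨ cong (3 ^ (2 + r) +_) (*-distribʳ-+ 720 s (3 ^ (r + j * 4))) ⟨
  3 ^ (2 + r) + (s + 3 ^ (r + j * 4)) * 720        ∎)
  where
  open ≡-Reasoning
  shift : ∀ r q → r + (4 + q) ≡ 4 + (r + q)
  shift = solve-∀
  lemma : ∀ x → 3 * (3 * (3 * (3 * (3 * (3 * x))))) ≡ 3 * (3 * x) + x * 720
  lemma = solve-∀

period∣720 : ∀ b s → ∃[ t ] s * 720 ≡ t * period b
period∣720 (low _)  s = s * 60 , sym (*-assoc s 60 12)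
period∣720 (high _) s = s * 48 , sym (*-assoc s 48 15)

-- The block exceeds 3^(2+r) by whole periods. Gliding through these first leaves a gap depending
-- only on `r` and `e`, from which `walk` can be evaluated.
cross : ∀ b r j e → exponent b ≡ r + j * 4 → e + 2 ≤ 3 ^ (2 + r) →
  Run (start b + e) (place b (walk 99 b (3 ^ (2 + r) ∸ e)))
cross b r j e exponent≡ e+2≤
  with s , size≡ ← size-cyclic r j
  with t , s*720≡ ← period∣720 b s
  = glide-periods b t (m≤m+n _ e) (≤-trans (+-monoʳ-≤ (start b + e) (+-monoʳ-≤ (t * period b) 2≤g))
      (≤-reflexive (trans (sym (+-assoc (start b + e) _ g)) k+g≡))) ◅◅
    -- In every use r ≤ 3, so the gap is at most 243; strides average 4 or 5, and 99 units of fuel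
    -- suffice.
    walk-run 99 b g (≤-trans (m≤m+n _ e) (m≤m+n _ (t * period b))) k+g≡
  where
  M = 3 ^ (2 + r)
  g = M ∸ e

  2≤g : 2 ≤ g
  2≤g = m+n≤o⇒m≤o∸n 2 (subst (_≤ M) (+-comm e 2) e+2≤)

  lemma : ∀ b e q g → b + e + q + g ≡ b + (e + g + q)
  lemma = solve-∀

  k+g≡ : start b + e + t * period b + g ≡ end b
  k+g≡ = trans (lemma (start b) e (t * period b) g) (trans
    (cong (start b +_) (trans (cong₂ _+_ (m+[n∸m]≡n (m+n≤o⇒m≤o e e+2≤)) (sym s*720≡))
      (sym (trans (cong size exponent≡) size≡))))
    (sym (end≡start+size b)))

-- For numerals `r` and `e` the endpoint computes. As 4 + j * 4 is (1 + j) * 4 by definition,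
-- consecutive crossings compose without transport.
cross-low : ∀ r j e {_ : True (e + 2 ≤? 3 ^ (2 + r))} → let b = low (r + j * 4) in
  Run (start b + e) (place b (walk 99 b (3 ^ (2 + r) ∸ e)))
cross-low r j e {p} = cross (low _) r j e refl (toWitness p)

cross-high : ∀ r j e {_ : True (e + 2 ≤? 3 ^ (2 + r))} → let b = high (r + j * 4) in
  Run (start b + e) (place b (walk 99 b (3 ^ (2 + r) ∸ e)))
cross-high r j e {p} = cross (high _) r j e refl (toWitness p)

-- Forks and dead ends

5≤end : ∀ b → 5 ≤ end b
5≤end b = ≤-trans (≤-trans (m≤m+n 5 4) (m≤n+m 9 (start b))) (start+9≤end b)

fork : ℕ → ℕ
fork m = end (low m) ∸ 5

-- The last digit of `k` is 1, so the candidates `k + 4` and `k + 5` are the last number of `b` and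
-- the first of the next block. For `b` low they lead with 1 and 2, as required, and both are
-- children; for `b` high they lead with 2 and 1, and neither is.
module Brink (b : Block) where

  k = end b ∸ 5

  k+5≡ : k + 5 ≡ end b
  k+5≡ = m∸n+n≡m (5≤end b)

  k+4≡ : k + 4 ≡ end b ∸ 1
  k+4≡ = trans (sym (m+n∸n≡m (k + 4) 1)) (cong (_∸ 1) (trans (+-assoc k 4 1) k+5≡))

  k%3≡1 : k % 3 ≡ 1
  k%3≡1 = last-digit-gap b k 5 k+5≡

  start≤k : start b ≤ k
  start≤k = m+n≤o⇒m≤o∸n (start b) (≤-trans (+-monoʳ-≤ (start b) (m≤m+n 5 4)) (start+9≤end b))

  k+4-lead : LeadingDigit 3 (k + 4) (lead b)
  k+4-lead = LeadingDigit-block b (≤-trans start≤k (m≤m+n k 4))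
    (<-≤-trans (+-monoʳ-< k (n<1+n 4)) (≤-reflexive k+5≡))

  end-lead : LeadingDigit 3 (end b) (lead (next b))
  end-lead = LeadingDigit-block (next b) ≤-refl
    (<-≤-trans (m<m+n (end b) (s≤s z≤n)) (start+9≤end (next b)))

  k+5-lead : LeadingDigit 3 (k + 5) (lead (next b))
  k+5-lead = subst (λ n → LeadingDigit 3 n (lead (next b))) (sym k+5≡) end-lead

  brink-digit : ∀ δ → LeadingDigit 3 (k + (3 + toℕ δ)) δ →
    lead b ≡ 1F × δ ≡ 1F ⊎ lead (next b) ≡ 2F × δ ≡ 2F
  brink-digit 0F (() , _)
  brink-digit 1F leading = inj₁ (LeadingDigit-unique k+4-lead leading , refl)
  brink-digit 2F leading = inj₂ (LeadingDigit-unique k+5-lead leading , refl)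

  children : ∀ {i} → CommaChild 3 k i →
    (lead b ≡ 1F × i ≡ k + 4) ⊎ (lead (next b) ≡ 2F × i ≡ k + 5)
  children {i} c = Sum.map at at
    (brink-digit δ (subst (λ n → LeadingDigit 3 n δ) i≡ (CommaChild.δ-leading c)))
    where
    δ = CommaChild.δ c

    i≡ : i ≡ k + (3 + toℕ δ)
    i≡ = trans (CommaChild.k′≡k+[d*b+δ] c) (cong (λ d → k + (d * 3 + toℕ δ)) k%3≡1)

    at : ∀ {A : Set} {η : Digit 3} → A × δ ≡ η → A × i ≡ k + (3 + toℕ η)
    at (a , δ≡η) = a , trans i≡ (cong (λ x → k + (3 + toℕ x)) δ≡η)

  child : ∀ δ → LeadingDigit 3 (k + (3 + toℕ δ)) δ → CommaChild 3 k (k + (3 + toℕ δ))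
  child δ leading = record
    { k-positive = ≤-trans (0<start b) start≤k
    ; k′-positive = ≤-trans (0<start b) (≤-trans start≤k (m≤m+n k _))
    ; δ = δ
    ; δ-leading = leading
    ; k′≡k+[d*b+δ] = cong (λ d → k + (d * 3 + toℕ δ)) (sym k%3≡1)
    }

fork-children : ∀ m → TwoChildren 3 (fork m) (end (low m) ∸ 1) (end (low m))
fork-children m =
  subst₂ _<_ k+4≡ k+5≡ (+-monoʳ-< k (n<1+n 4)) ,
  subst (CommaChild 3 k) k+4≡ (child 1F k+4-lead) ,
  subst (CommaChild 3 k) k+5≡ (child 2F k+5-lead) ,
  λ i c → [ (λ p → inj₁ (trans (proj₂ p) k+4≡)) , (λ p → inj₂ (trans (proj₂ p) k+5≡)) ]′ (children c)
  where open Brink (low m)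

-- No infinite path starts at k, in a form that asks for no classical reasoning.
data Dead (k : ℕ) : Set where
  dead : (∀ {j} → CommaChild 3 k j → Dead j) → Dead k

Dead-high-end : ∀ m → Dead (end (high m) ∸ 5)
Dead-high-end m = dead λ c → case Brink.children (high m) c of λ where
  (inj₁ (() , _))
  (inj₂ (() , _))

Dead-run : ∀ {k l} → Run k l → Dead l → Dead k
Dead-run ε        x = x
Dead-run (o ◅ os) x = dead λ c → subst Dead (sym (proj₂ o _ c)) (Dead-run os x)

Dead-fork : ∀ m → Dead (end (low m) ∸ 1) → Dead (end (low m)) → Dead (fork m)
Dead-fork m x y = dead λ c → [ (λ { refl → x }) , (λ { refl → y }) ]′
  (proj₂ (proj₂ (proj₂ (fork-children m))) _ c)

Dead-path : ∀ {s a} → InfinitePathFrom 3 s a → ∀ n → Dead (a n) → ⊥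
Dead-path p n (dead f) = Dead-path p (suc n) (f (proj₂ p n))

-- Runs from the children of branch-points

from-start : ∀ b {l} → Run (start b + 0) l → Run (start b) l
from-start b {l} = subst (λ k → Run k l) (+-identityʳ (start b))

-- The last digit of `end (low m) ∸ 1` is 2 and the new leading digit is 2, so the step is 2 * 3 + 2
-- = 8.
run-to-high : ∀ m → Run (end (low m) ∸ 1) (end (low m) + 7)
run-to-high m = subst (λ k → Run k (end (low m) + 7)) k+4≡ (walk-run 1 (low m) 1
  (≤-trans start≤k (m≤m+n k 4)) (trans (+-assoc k 4 1) k+5≡))
  where open Brink (low m)

-- The last argument of each crossing is the offset at which the run enters that block, as computed
-- by `walk` on the block before. Both runs halt 5 short of a power of 3.
Dead-fork-1 : ∀ j → Dead (fork (1 + j * 4))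
Dead-fork-1 j = Dead-fork (1 + j * 4)
  (Dead-run (run-to-high (1 + j * 4) ◅◅ cross-high 1 j 7) (Dead-high-end _))
  (Dead-run (from-start (high (1 + j * 4)) (cross-high 1 j 0) ◅◅ cross-low 2 j 2 ◅◅ cross-high 2 j 1)
    (Dead-high-end _))

Dead-fork-2 : ∀ j → Dead (fork (2 + j * 4))
Dead-fork-2 j = Dead-fork (2 + j * 4)
  (Dead-run (run-to-high (2 + j * 4) ◅◅ cross-high 2 j 7 ◅◅ cross-low 3 j 0 ◅◅ cross-high 3 j 3)
    (Dead-high-end _))
  (Dead-run
    ( from-start (high (2 + j * 4)) (cross-high 2 j 0) ◅◅ cross-low 3 j 3 ◅◅ cross-high 3 j 1
    ◅◅ cross-low 0 (1 + j) 2 ◅◅ cross-high 0 (1 + j) 1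
    ◅◅ cross-low 1 (1 + j) 6 ◅◅ cross-high 1 (1 + j) 4
    ◅◅ cross-low 2 (1 + j) 6 ◅◅ cross-high 2 (1 + j) 3
    ◅◅ cross-low 3 (1 + j) 6 ◅◅ cross-high 3 (1 + j) 4
    ◅◅ cross-low 0 (2 + j) 0 ◅◅ cross-high 0 (2 + j) 4)
    (Dead-high-end _))

-- Shared by two rejected branches: the child 6 of 1, and the higher child at `fork (3 + j * 4)`.
Dead-low-6 : ∀ j → Dead (start (low (j * 4)) + 6)
Dead-low-6 j = Dead-run
  ( cross-low 0 j 6 ◅◅ cross-high 0 j 3 ◅◅ cross-low 1 j 3 ◅◅ cross-high 1 j 1
  ◅◅ cross-low 2 j 3)
  (Dead-fork-2 j)

Dead-fork-0-lower : ∀ j → Dead (end (low (j * 4)) ∸ 1)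
Dead-fork-0-lower j =
  Dead-run (run-to-high (j * 4) ◅◅ cross-high 0 j 7 ◅◅ cross-low 1 j 2) (Dead-fork-1 j)

Dead-fork-3-higher : ∀ j → Dead (end (low (3 + j * 4)))
Dead-fork-3-higher j =
  Dead-run (from-start (high (3 + j * 4)) (cross-high 3 j 0)) (Dead-low-6 (1 + j))

-- The infinite path

State : Set
State = Choice × ℕ

-- Couples the rule with uniqueness: an infinite path at `k` must go to `k′`, since every other
-- child is dead.
Forced : State → State → Set
Forced (c , k) (c′ , k′) = Move 3 c k c′ k′ × (∀ i → CommaChild 3 k i → i ≡ k′ ⊎ Dead i)

Trail : State → State → Set
Trail = Star Forced

forced-lower : ∀ {k l h} → TwoChildren 3 k l h → Dead h → Forced (lower , k) (higher , l)
forced-lower {h = h} t x = go-lower t ,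
  λ i c → Sum.map₂ (λ i≡h → subst Dead (sym i≡h) x) (proj₂ (proj₂ (proj₂ t)) i c)

forced-higher : ∀ {k l h} → TwoChildren 3 k l h → Dead l → Forced (higher , k) (lower , h)
forced-higher t x = go-higher t ,
  λ i c → Sum.swap (Sum.map₁ (λ i≡l → subst Dead (sym i≡l) x) (proj₂ (proj₂ (proj₂ t)) i c))

run-trail : ∀ {c k l} → Run k l → Trail (c , k) (c , l)
run-trail {c} = gmap (λ k → c , k) λ o → only o , λ i ch → inj₁ (proj₂ o i ch)

-- Serves the few nodes below the first block, with the bounds checked by evaluation.
lone-child : ∀ k m (δ : Digit 3) {_ : True (0 <? k)} {_ : True (0 <? toℕ δ)}
  {_ : True (toℕ δ * 3 ^ m ≤? k + (k % 3 * 3 + 1))}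
  {_ : True (k + (k % 3 * 3 + 2) <? suc (toℕ δ) * 3 ^ m)} →
  OnlyChild 3 k (k + (k % 3 * 3 + toℕ δ))
lone-child k m δ {p} {q} {r} {s} = isolate (toWitness p) refl (toWitness q) λ lo hi →
  LeadingDigit-intro m (toWitness q) (≤-trans (toWitness r) lo) (≤-<-trans hi (toWitness s))

children-of-1 : TwoChildren 3 1 5 6
children-of-1 = n<1+n 5 , child 1F (2F ∷ []) refl , child 2F (0F ∷ []) refl , λ i → cases
  where
  child : ∀ δ {_ : True (0 <? toℕ δ)} ds → fromDigits (ds ∷ʳ δ) ≡ 4 + toℕ δ →
    CommaChild 3 1 (4 + toℕ δ)
  child δ {p} ds eq = record
    { k-positive = s≤s z≤n
    ; k′-positive = s≤s z≤n
    ; δ = δ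
    ; δ-leading = toWitness p , ds , eq
    ; k′≡k+[d*b+δ] = refl
    }

  cases : ∀ {i} → CommaChild 3 1 i → i ≡ 5 ⊎ i ≡ 6
  cases record { δ = 0F ; δ-leading = () , _ }
  cases record { δ = 1F ; k′≡k+[d*b+δ] = eq } = inj₁ eq
  cases record { δ = 2F ; k′≡k+[d*b+δ] = eq } = inj₂ eq

Dead-6 : Dead 6
Dead-6 = Dead-run (lone-child 6 1 2F ◅ lone-child 8 2 1F ◅ ε)
  (subst Dead (cong (_+ 6) (size-unfold 0)) (Dead-low-6 0))

-- The recurring branch-points 2Q - 5 with Q = 9·81^j, preceded by the start 1.
hub : ℕ → State
hub zero    = lower , 1
hub (suc j) = higher , fork (j * 4)

-- The first edge is kept apart so that each leg is visibly nonempty.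
hub-trail : ∀ j → ∃[ x ] Forced (hub j) x × Trail x (hub (suc j))
hub-trail zero = _ , forced-lower children-of-1 Dead-6 ,
  subst (λ k → Trail (higher , 5) (higher , k)) (cong (λ n → 2 * n ∸ 5) (sym (size-unfold 0)))
    (run-trail (lone-child 5 2 1F ◅ lone-child 12 2 1F ◅ ε))
hub-trail (suc j) = _ , forced-higher (fork-children (j * 4)) (Dead-fork-0-lower j) ,
  ( run-trail
      ( from-start (high (j * 4)) (cross-high 0 j 0)
      ◅◅ cross-low 1 j 0 ◅◅ cross-high 1 j 3 ◅◅ cross-low 2 j 0 ◅◅ cross-high 2 j 4
      ◅◅ cross-low 3 j 2 )
  ◅◅ forced-lower (fork-children (3 + j * 4)) (Dead-fork-3-higher j)
  ◅ run-trail (run-to-high (3 + j * 4) ◅◅ cross-high 3 j 7 ◅◅ cross-low 0 (1 + j) 3) )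

-- A position on the infinite concatenation of the legs. An edge is always pending, so `advance`
-- needs no recursion.
record Cursor : Set where
  field
    leg   : ℕ
    here  : State
    there : State
    now   : Forced here there
    later : Trail there (hub (suc leg))

open Cursor

embark : ℕ → Cursor
embark j = record
  { leg = j
  ; now = proj₁ (proj₂ (hub-trail j))
  ; later = proj₂ (proj₂ (hub-trail j))
  }

advance : Cursor → Cursor
advance record { leg = j ; later = ε }      = embark (suc j)
advance record { leg = j ; later = f ◅ fs } = record { leg = j ; now = f ; later = fs }

here-advance : ∀ p → here (advance p) ≡ there p
here-advance record { later = ε }     = refl
here-advance record { later = _ ◅ _ } = refl

voyage : ℕ → Cursor
voyage zero    = embark 0
voyage (suc n) = advance (voyage n)

choice : ℕ → Choice
choice n = proj₁ (here (voyage n))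

node : ℕ → ℕ
node n = proj₂ (here (voyage n))

node-forced : ∀ n → Forced (choice n , node n) (choice (suc n) , node (suc n))
node-forced n = subst (Forced (here (voyage n))) (sym (here-advance (voyage n))) (now (voyage n))

Move-child : ∀ {c k c′ k′} → Move 3 c k c′ k′ → CommaChild 3 k k′
Move-child (only o)      = proj₁ o
Move-child (go-lower t)  = proj₁ (proj₂ t)
Move-child (go-higher t) = proj₁ (proj₂ (proj₂ t))

node-path : InfinitePathFrom 3 1 node
node-path = refl , λ n → Move-child (proj₁ (node-forced n))

-- At the first divergence the other path would be at a dead node, which no infinite path visits.
node-unique : ∀ {a} → InfinitePathFrom 3 1 a → node ≗ a
node-unique p zero = sym (proj₁ p)
node-unique {a} p (suc n) with proj₂ (node-forced n) (a (suc n))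
  (subst (λ k → CommaChild 3 k (a (suc n))) (sym (node-unique p n)) (proj₂ p n))
... | inj₁ eq = sym eq
... | inj₂ x  = ⊥-elim (Dead-path p (suc n) x)

theorem10p1 : ∃! _≗_ (InfinitePathFrom 3 1) ×
    BranchPoint 3 1 ×
    (∀ (a : ℕ → ℕ) → InfinitePathFrom 3 1 a → FollowsAlternatingRule 3 a)
theorem10p1 =
  (node , node-path , node-unique) ,
  (5 , 6 , children-of-1) ,
  λ a p → choice , refl , λ n →
    subst₂ (λ k k′ → Move 3 (choice n) k (choice (suc n)) k′)
      (node-unique p n) (node-unique p (suc n)) (proj₁ (node-forced n))
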